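{- Let $\Delta$ be the marked group $\mathbb{Z}\rtimes_\varphi\mathbb{Z}$, where $\varphi:\mathbb{Z}\to\mathrm{Aut}(\mathbb{Z})$ sends $1$ to the inversion map (so the product is $(a,m)(b,n)=(a+(-1)^m b,m+n)$), with generating set $\{(\pm 2,0),(\pm 3,0),(0,1),(0,-1)\}$. Then $\chi_B(F(2^\Delta))>3$.
   Context: A marked group is a finitely generated group $\Gamma$ with a finite symmetric generating set $S$ not containing the identity. The left shift action of $\Gamma$ on $2^\Gamma$ is $(g\cdot x)(h)=x(g^{ -1}h)$; its free part is $F(2^\Gamma)=\{x\in 2^\Gamma : g\cdot x\neq x \text{ for all } g\neq \mathrm{id}\}$. The shift graph $F(2^\Gamma)$ is the graph on this free part joining distinct $x,y$ iff $s\cdot x=y$ for some $s\in S$. $\chi_B(G)$ denotes the Borel chromatic number: the least $k$ such that there is a Borel map $c$ from the vertex set to a $k$-element set with $c(x)\neq c(y)$ for adjacent $x,y$. -}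

module Defs where

open import Data.Nat as ℕ using (ℕ)
open import Data.Nat.DivMod using (_%_)
open import Data.Integer using (ℤ; +_; -_; _+_; ∣_∣; 0ℤ; 1ℤ)
open import Data.Bool using (Bool)
open import Data.Fin using (Fin)
open import Data.Product using (Σ; _×_; _,_; proj₁)
open import Data.Sum using (_⊎_)
open import Relation.Binary.PropositionalEquality using (_≡_; _≢_)
open import Relation.Nullary using (¬_)

-- The group Δ = ℤ ⋊_φ ℤ, φ(1) = inversion.
-- (a,m)(b,n) = (a + (-1)^m b , m + n)

Δ : Set
Δ = ℤ × ℤ

signAct : ℤ → ℤ → ℤ
signAct m b with ∣ m ∣ % 2
... | 0 = b
... | _ = - b

_·Δ_ : Δ → Δ → Δ
(a , m) ·Δ (b , n) = (a + signAct m b , m + n)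

eΔ : Δ
eΔ = (0ℤ , 0ℤ)

invΔ : Δ → Δ
invΔ (a , m) = (- signAct m a , - m)

data Gen : Δ → Set where
  g+2 : Gen (+ 2 , 0ℤ)
  g-2 : Gen (- (+ 2) , 0ℤ)
  g+3 : Gen (+ 3 , 0ℤ)
  g-3 : Gen (- (+ 3) , 0ℤ)
  g+t : Gen (0ℤ , 1ℤ)
  g-t : Gen (0ℤ , - 1ℤ)

2^Δ : Set
2^Δ = Δ → Bool

shift : Δ → 2^Δ → 2^Δ
shift g x h = x (invΔ g ·Δ h)

_≐_ : 2^Δ → 2^Δ → Set
x ≐ y = ∀ h → x h ≡ y h

IsFree : 2^Δ → Set
IsFree x = ∀ g → g ≢ eΔ → ¬ (shift g x ≐ x)

Free : Set
Free = Σ 2^Δ IsFree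

Adj : Free → Free → Set
Adj (x , _) (y , _) = ¬ (x ≐ y) × Σ Δ (λ s → Gen s × (shift s x ≐ y))

-- Borel subsets of 2^Δ: the σ-algebra generated by the subbasic
-- clopen cylinders {x | x h = b}, presented by Borel codes.

data BorelCode : Set where
  cyl   : Δ → Bool → BorelCode
  compl : BorelCode → BorelCode
  union : (ℕ → BorelCode) → BorelCode

_∈B_ : 2^Δ → BorelCode → Set
x ∈B cyl h b    = x h ≡ b
x ∈B compl B    = ¬ (x ∈B B)
x ∈B union Bs   = Σ ℕ (λ n → x ∈B Bs n)

-- a map c : F(2^Δ) → Fin k is Borel (w.r.t. the subspace Borel structure)
-- if each colour class is the trace on F(2^Δ) of a Borel subset of 2^Δ
IsBorelMap : {k : ℕ} → (Free → Fin k) → Set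
IsBorelMap {k} c = ∀ (i : Fin k) → Σ BorelCode (λ B →
  ∀ (p : Free) → ((c p ≡ i → proj₁ p ∈B B) × (proj₁ p ∈B B → c p ≡ i)))

IsProperColoring : {k : ℕ} → (Free → Fin k) → Set
IsProperColoring c = ∀ p q → Adj p q → c p ≢ c q

BorelColorable : ℕ → Set
BorelColorable k = Σ (Free → Fin k) (λ c → IsBorelMap c × IsProperColoring c)

{-# OPTIONS --safe #-}

-- In the Cayley graph of ℤ with generators ±2, ±3 the vertices 0, 2, 4, 1, 3 form a
-- 5-cycle, around which a proper 3-colouring has a nonzero winding number.  Along an orbit
-- of Δ this number does not change under (1, 0), but changes sign under (0, 1), because
-- (0, 1) reverses the 5-cycle.  A Borel colouring would be decided, at a generic point x, by
-- finitely many values of x; some odd power of (0, 1) moves x to a point with those same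
-- values, hence with the same winding number, a contradiction.
--
-- Constructively, forcing and the generic point need WLPO.  It comes from the colouring
-- itself: an explicit free point x is a limit of translates of x with the opposite winding
-- number, and a point that equals x or one of these translates according to a
-- binary sequence α has the winding number of x exactly if α vanishes.

module Submission where

open import Defs
open import Algebra.Bundles using (Group)
import Algebra.Properties.Group as GroupProperties
open import Data.Bool using (Bool; true; false; if_then_else_; not)
import Data.Bool.Properties as Bool
open import Data.Empty using (⊥)
open import Data.Fin using (Fin; zero; suc)
open import Data.Fin.Properties as Fin using (all?)
open import Data.Integer using (ℤ; +_; +[1+_]; -[1+_]; -_; _+_; 0ℤ; 1ℤ; -1ℤ; ∣_∣)
import Data.Integer as ℤ
import Data.Integer.Properties as ℤ
open import Data.Integer.Tactic.RingSolver using (solve-∀)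
open import Data.List using (List; []; _∷_; _++_; length; map)
import Data.List.Properties as List
open import Data.Maybe using (Maybe; just; nothing; maybe; _<∣>_)
import Data.Maybe.Properties as Maybe
open import Data.Nat as ℕ using (ℕ; zero; suc; _≤_; _<_; _⊔_)
import Data.Nat.Properties as ℕ
open import Data.Product using (∃; ∃₂; _×_; _,_; proj₁; proj₂; map₁; map₂)
open import Data.Product.Properties using (≡-dec)
open import Data.Sum as Sum using (_⊎_; inj₁; inj₂; [_,_]′)
open import Function using (_∘_; case_of_)
open import Relation.Binary.Definitions using (DecidableEquality)
open import Relation.Binary.PropositionalEquality
open import Relation.Nullary using (¬_; Dec; yes; no; does; contradiction)
open import Relation.Nullary.Decidable
  using (from-yes; map′; ¬?; _→-dec_; _⊎-dec_; decidable-stable; dec-true; dec-false)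

-- The group structure of Δ.

signAct-+suc : ∀ n b → signAct (+ suc n) b ≡ - signAct (+ n) b
signAct-+suc zero b = refl
signAct-+suc (suc zero) b = sym (ℤ.neg-involutive b)
signAct-+suc (suc (suc n)) b = signAct-+suc n b

signAct-suc : ∀ m b → signAct (ℤ.suc m) b ≡ - signAct m b
signAct-suc (+ n) b = signAct-+suc n b
signAct-suc -[1+ zero ] b = sym (ℤ.neg-involutive b)
signAct-suc -[1+ suc n ] b =
  trans (sym (ℤ.neg-involutive _)) (cong -_ (sym (signAct-+suc (suc n) b)))

signAct-pred : ∀ m b → signAct (ℤ.pred m) b ≡ - signAct m b
signAct-pred m b = begin
  signAct (ℤ.pred m) b              ≡⟨ ℤ.neg-involutive _ ⟨
  - - signAct (ℤ.pred m) b          ≡⟨ cong -_ (signAct-suc (ℤ.pred m) b) ⟨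
  - signAct (ℤ.suc (ℤ.pred m)) b    ≡⟨ cong (λ k → - signAct k b) (ℤ.suc-pred m) ⟩
  - signAct m b                     ∎
  where open ≡-Reasoning

signAct-homo : ∀ m n b → signAct (m + n) b ≡ signAct m (signAct n b)
signAct-homo (+ zero) n b = cong (λ k → signAct k b) (ℤ.+-identityˡ n)
signAct-homo (+ suc m) n b = begin
  signAct (+ suc m + n) b           ≡⟨ cong (λ k → signAct k b) (ℤ.suc-+ m n) ⟩
  signAct (ℤ.suc (+ m + n)) b       ≡⟨ signAct-suc (+ m + n) b ⟩
  - signAct (+ m + n) b             ≡⟨ cong -_ (signAct-homo (+ m) n b) ⟩
  - signAct (+ m) (signAct n b)     ≡⟨ signAct-suc (+ m) (signAct n b) ⟨
  signAct (+ suc m) (signAct n b)   ∎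
  where open ≡-Reasoning
signAct-homo -[1+ zero ] n b = signAct-pred n b
signAct-homo -[1+ suc m ] n b = begin
  signAct (ℤ.pred -[1+ m ] + n) b         ≡⟨ cong (λ k → signAct k b) (ℤ.pred-+ -[1+ m ] n) ⟩
  signAct (ℤ.pred (-[1+ m ] + n)) b       ≡⟨ signAct-pred (-[1+ m ] + n) b ⟩
  - signAct (-[1+ m ] + n) b              ≡⟨ cong -_ (signAct-homo -[1+ m ] n b) ⟩
  - signAct -[1+ m ] (signAct n b)        ≡⟨ signAct-pred -[1+ m ] (signAct n b) ⟨
  signAct (ℤ.pred -[1+ m ]) (signAct n b) ∎
  where open ≡-Reasoning

signAct-distrib-+ : ∀ m a b → signAct m (a + b) ≡ signAct m a + signAct m b
signAct-distrib-+ m a b with ∣ m ∣ ℕ.% 2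
... | 0     = refl
... | suc _ = ℤ.neg-distrib-+ a b

signAct-neg : ∀ m a → signAct m (- a) ≡ - signAct m a
signAct-neg m a with ∣ m ∣ ℕ.% 2
... | 0     = refl
... | suc _ = refl

·Δ-assoc : ∀ g h k → (g ·Δ h) ·Δ k ≡ g ·Δ (h ·Δ k)
·Δ-assoc (a , m) (b , n) (c , o) = cong₂ _,_ first (ℤ.+-assoc m n o)
  where
  open ≡-Reasoning
  first : a + signAct m b + signAct (m + n) c ≡ a + signAct m (b + signAct n c)
  first = begin
    a + signAct m b + signAct (m + n) c             ≡⟨ ℤ.+-assoc a _ _ ⟩
    a + (signAct m b + signAct (m + n) c)           ≡⟨ cong (λ z → a + (signAct m b + z)) (signAct-homo m n c) ⟩
    a + (signAct m b + signAct m (signAct n c))     ≡⟨ cong (λ z → a + z) (signAct-distrib-+ m b (signAct n c)) ⟨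
    a + signAct m (b + signAct n c)                 ∎

·Δ-identityˡ : ∀ g → eΔ ·Δ g ≡ g
·Δ-identityˡ (a , m) = cong₂ _,_ (ℤ.+-identityˡ a) (ℤ.+-identityˡ m)

·Δ-inverseˡ : ∀ g → invΔ g ·Δ g ≡ eΔ
·Δ-inverseˡ (a , m) = cong₂ _,_ first (ℤ.+-inverseˡ m)
  where
  first : - signAct m a + signAct (- m) a ≡ 0ℤ
  first = trans (cong (λ z → - z + signAct (- m) a) (even m)) (ℤ.+-inverseˡ (signAct (- m) a))
    where
    even : ∀ m → signAct m a ≡ signAct (- m) a
    even (+ zero)  = refl
    even +[1+ _ ]  = refl
    even -[1+ _ ]  = refl

·Δ-identityʳ : ∀ g → g ·Δ eΔ ≡ g
·Δ-identityʳ (a , m) = cong₂ _,_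
  (trans (cong (λ z → a + z) (signAct-0 m)) (ℤ.+-identityʳ a)) (ℤ.+-identityʳ m)
  where
  signAct-0 : ∀ m → signAct m 0ℤ ≡ 0ℤ
  signAct-0 m with ∣ m ∣ ℕ.% 2
  ... | 0     = refl
  ... | suc _ = refl

·Δ-inverseʳ : ∀ g → g ·Δ invΔ g ≡ eΔ
·Δ-inverseʳ (a , m) = cong₂ _,_ first (ℤ.+-inverseʳ m)
  where
  open ≡-Reasoning
  first : a + signAct m (- signAct m a) ≡ 0ℤ
  first = begin
    a + signAct m (- signAct m a) ≡⟨ cong (λ z → a + z) (signAct-neg m _) ⟩
    a + - signAct m (signAct m a) ≡⟨ cong (λ z → a + - z) (signAct-involutive m) ⟩
    a + - a                       ≡⟨ ℤ.+-inverseʳ a ⟩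
    0ℤ                            ∎
    where
    signAct-involutive : ∀ m → signAct m (signAct m a) ≡ a
    signAct-involutive m with ∣ m ∣ ℕ.% 2
    ... | 0     = refl
    ... | suc _ = ℤ.neg-involutive a

Δ-group : Group _ _
Δ-group = record
  { _∙_ = _·Δ_
  ; ε = eΔ
  ; _⁻¹ = invΔ
  ; isGroup = record
    { isMonoid = record
      { isSemigroup = record
        { isMagma = record { isEquivalence = isEquivalence ; ∙-cong = cong₂ _·Δ_ }
        ; assoc = ·Δ-assoc
        }
      ; identity = ·Δ-identityˡ , ·Δ-identityʳ
      }
    ; inverse = ·Δ-inverseˡ , ·Δ-inverseʳ
    ; ⁻¹-cong = cong invΔ
    }
  }

-- Winding numbers of proper 3-colourings of ℤ.

-- The representative in {-1, 0, 1} of v - u modulo 3.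
δ : Fin 3 → Fin 3 → ℤ
δ zero             zero             = 0ℤ
δ zero             (suc zero)       = 1ℤ
δ zero             (suc (suc zero)) = -1ℤ
δ (suc zero)       zero             = -1ℤ
δ (suc zero)       (suc zero)       = 0ℤ
δ (suc zero)       (suc (suc zero)) = 1ℤ
δ (suc (suc zero)) zero             = 1ℤ
δ (suc (suc zero)) (suc zero)       = -1ℤ
δ (suc (suc zero)) (suc (suc zero)) = 0ℤ

δ-antisym : ∀ u v → δ u v ≡ - δ v u
δ-antisym = from-yes (all? λ u → all? λ v → δ u v ℤ.≟ - δ v u)

_≢?_ : (u v : Fin 3) → Dec (u ≢ v)
u ≢? v = ¬? (u Fin.≟ v)

-- Around a closed walk of length 4 the four terms are ±1 and their sum is even and divisible by 3;
-- a multiple of 6 of absolute value at most 4 is 0.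
δ-square : ∀ u v w z → u ≢ v → v ≢ w → w ≢ z → z ≢ u → δ u v + δ v w ≡ δ u z + δ z w
δ-square = from-yes (all? λ u → all? λ v → all? λ w → all? λ z →
  (u ≢? v) →-dec (v ≢? w) →-dec (w ≢? z) →-dec (z ≢? u) →-dec
  (δ u v + δ v w ℤ.≟ δ u z + δ z w))

-- Three times the winding number of a closed walk of length 5 around the triangle of colours.
cycleSum : (u v w x y : Fin 3) → ℤ
cycleSum u v w x y = δ u v + δ v w + δ w x + δ x y + δ y u

cycleSum-cong : ∀ {u v w x y u′ v′ w′ x′ y′} → u ≡ u′ → v ≡ v′ → w ≡ w′ → x ≡ x′ → y ≡ y′ →
  cycleSum u v w x y ≡ cycleSum u′ v′ w′ x′ y′
cycleSum-cong refl refl refl refl refl = refl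

-- A sum of five terms ±1 is odd.
cycleSum≢0 : ∀ u v w x y → u ≢ v → v ≢ w → w ≢ x → x ≢ y → y ≢ u → cycleSum u v w x y ≢ 0ℤ
cycleSum≢0 = from-yes (all? λ u → all? λ v → all? λ w → all? λ x → all? λ y →
  (u ≢? v) →-dec (v ≢? w) →-dec (w ≢? x) →-dec (x ≢? y) →-dec (y ≢? u) →-dec
  ¬? (cycleSum u v w x y ℤ.≟ 0ℤ))

-- In the Cayley graph of ℤ with generators ±2, ±3, the vertices 0, 2, 4, 1, 3 form a 5-cycle.
wind : (ℤ → Fin 3) → ℤ
wind f = cycleSum (f (+ 0)) (f (+ 2)) (f (+ 4)) (f (+ 1)) (f (+ 3))

Proper : (ℤ → Fin 3) → Set
Proper f = ∀ k → (f k ≢ f (k + + 2)) × (f k ≢ f (k + + 3))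

wind≢0 : ∀ f → Proper f → wind f ≢ 0ℤ
wind≢0 f proper = cycleSum≢0 _ _ _ _ _
  (proj₁ (proper (+ 0))) (proj₁ (proper (+ 2))) (≢-sym (proj₂ (proper (+ 1))))
  (proj₁ (proper (+ 1))) (≢-sym (proj₂ (proper (+ 0))))

shiftBy : ℤ → (ℤ → Fin 3) → ℤ → Fin 3
shiftBy j f k = f (j + k)

shiftBy-proper : ∀ j f → Proper f → Proper (shiftBy j f)
shiftBy-proper j f proper k =
  subst (λ l → f (j + k) ≢ f l) (ℤ.+-assoc j k (+ 2)) (proj₁ (proper (j + k))) ,
  subst (λ l → f (j + k) ≢ f l) (ℤ.+-assoc j k (+ 3)) (proj₂ (proper (j + k)))

-- Translating the 5-cycle by 1 amounts to replacing its vertex 0 by 5, which has the same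
-- neighbours 2 and 3.
wind-shift1 : ∀ f → Proper f → wind (shiftBy 1ℤ f) ≡ wind f
wind-shift1 f proper = begin
  δ (f (+ 1)) (f (+ 3)) + δ (f (+ 3)) (f (+ 5)) + δ (f (+ 5)) (f (+ 2)) + q + p
    ≡⟨ regroup (δ (f (+ 1)) (f (+ 3))) (δ (f (+ 3)) (f (+ 5))) (δ (f (+ 5)) (f (+ 2))) q p ⟩
  (δ (f (+ 3)) (f (+ 5)) + δ (f (+ 5)) (f (+ 2))) + q + p + δ (f (+ 1)) (f (+ 3))
    ≡⟨ cong (λ z → z + q + p + δ (f (+ 1)) (f (+ 3))) square ⟩
  (δ (f (+ 3)) (f (+ 0)) + δ (f (+ 0)) (f (+ 2))) + q + p + δ (f (+ 1)) (f (+ 3))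
    ≡⟨ regroup′ (δ (f (+ 3)) (f (+ 0))) (δ (f (+ 0)) (f (+ 2))) q p (δ (f (+ 1)) (f (+ 3))) ⟩
  wind f ∎
  where
  open ≡-Reasoning
  q = δ (f (+ 2)) (f (+ 4))
  p = δ (f (+ 4)) (f (+ 1))
  square = δ-square (f (+ 3)) (f (+ 5)) (f (+ 2)) (f (+ 0))
    (proj₁ (proper (+ 3))) (≢-sym (proj₂ (proper (+ 2))))
    (≢-sym (proj₁ (proper (+ 0)))) (proj₂ (proper (+ 0)))
  regroup : ∀ a b c d e → a + b + c + d + e ≡ (b + c) + d + e + a
  regroup = solve-∀
  regroup′ : ∀ b c d e a → (b + c) + d + e + a ≡ c + d + e + a + b
  regroup′ = solve-∀

-- Needed for reflection: negation maps the 5-cycle onto its translate by -4, with the orientation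
-- reversed.
wind-shift-4 : ∀ f → Proper f → wind (shiftBy (- + 4) f) ≡ wind f
wind-shift-4 f proper = sym (begin
  -- `wind` evaluates its argument at numerals only, so a translation by 1 after one by -n is, by
  -- computation, one by 1 - n.
  wind f                       ≡⟨ wind-shift1 (shiftBy (- + 1) f) (shiftBy-proper (- + 1) f proper) ⟩
  wind (shiftBy (- + 1) f)     ≡⟨ wind-shift1 (shiftBy (- + 2) f) (shiftBy-proper (- + 2) f proper) ⟩
  wind (shiftBy (- + 2) f)     ≡⟨ wind-shift1 (shiftBy (- + 3) f) (shiftBy-proper (- + 3) f proper) ⟩
  wind (shiftBy (- + 3) f)     ≡⟨ wind-shift1 (shiftBy (- + 4) f) (shiftBy-proper (- + 4) f proper) ⟩
  wind (shiftBy (- + 4) f)     ∎)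
  where open ≡-Reasoning

-- The two closed walks bound a prism: its five squares contribute 0 by `δ-square`, and the rungs
-- cancel in the sum.
cycleSum-adjacent : ∀ u v w x y u′ v′ w′ x′ y′ →
  u ≢ v → v ≢ w → w ≢ x → x ≢ y → y ≢ u →
  u′ ≢ v′ → v′ ≢ w′ → w′ ≢ x′ → x′ ≢ y′ → y′ ≢ u′ →
  u ≢ u′ → v ≢ v′ → w ≢ w′ → x ≢ x′ → y ≢ y′ →
  cycleSum u v w x y ≡ cycleSum u′ v′ w′ x′ y′
cycleSum-adjacent u v w x y u′ v′ w′ x′ y′ uv vw wx xy yu uv′ vw′ wx′ xy′ yu′ uu vv ww xx yy = begin
  cycleSum u v w x y
    ≡⟨ cong₂ _+_ (cong₂ _+_ (cong₂ _+_ (cong₂ _+_ (edge uv uv′ uu vv) (edge vw vw′ vv ww))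
         (edge wx wx′ ww xx)) (edge xy xy′ xx yy)) (edge yu yu′ yy uu) ⟩
  _ ≡⟨ telescope (δ u′ v′) (δ v′ w′) (δ w′ x′) (δ x′ y′) (δ y′ u′)
         (δ u u′) (δ v v′) (δ w w′) (δ x x′) (δ y y′) ⟩
  cycleSum u′ v′ w′ x′ y′ ∎
  where
  open ≡-Reasoning
  edge : ∀ {u v u′ v′} → u ≢ v → u′ ≢ v′ → u ≢ u′ → v ≢ v′ → δ u v ≡ δ u u′ + δ u′ v′ + - δ v v′
  edge {u} {v} {u′} {v′} uv uv′ uu vv = begin
    δ u v                           ≡⟨ cancel (δ u v) (δ v v′) ⟩
    δ u v + δ v v′ + - δ v v′       ≡⟨ cong (λ z → z + - δ v v′)
                                         (δ-square u v v′ u′ uv vv (≢-sym uv′) (≢-sym uu)) ⟩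
    δ u u′ + δ u′ v′ + - δ v v′     ∎
    where
    cancel : ∀ a b → a ≡ a + b + - b
    cancel = solve-∀
  telescope : ∀ a b c d e s t p q r →
    (s + a + - t) + (t + b + - p) + (p + c + - q) + (q + d + - r) + (r + e + - s) ≡ a + b + c + d + e
  telescope = solve-∀

cycleSum-reverse : ∀ u v w x y → cycleSum u v w x y ≡ - cycleSum u y x w v
cycleSum-reverse u v w x y
  rewrite δ-antisym u v | δ-antisym v w | δ-antisym w x | δ-antisym x y | δ-antisym y u =
  lemma (δ v u) (δ w v) (δ x w) (δ y x) (δ u y)
  where
  lemma : ∀ a b c d e → - a + - b + - c + - d + - e ≡ - (e + d + c + b + a)
  lemma = solve-∀

cycleSum-rotate : ∀ u v w x y → cycleSum u v w x y ≡ cycleSum v w x y u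
cycleSum-rotate u v w x y = lemma (δ u v) (δ v w) (δ w x) (δ x y) (δ y u)
  where
  lemma : ∀ a b c d e → a + b + c + d + e ≡ b + c + d + e + a
  lemma = solve-∀

-- The pairs `g k`, `f (- k)` are the rungs of a prism over the 5-cycle, so `g` winds as `f` does
-- along the negated 5-cycle, which is a translate of the 5-cycle run backwards.
wind-reflect : ∀ f g → Proper f → Proper g → (∀ k → g k ≢ f (- k)) → wind g ≡ - wind f
wind-reflect f g properf properg adj = begin
  wind g
    ≡⟨ cycleSum-adjacent _ _ _ _ _ _ _ _ _ _
         (proj₁ (properg (+ 0))) (proj₁ (properg (+ 2))) (≢-sym (proj₂ (properg (+ 1))))
         (proj₁ (properg (+ 1))) (≢-sym (proj₂ (properg (+ 0))))
         (≢-sym (proj₁ (properf (- + 2)))) (≢-sym (proj₁ (properf (- + 4)))) (proj₂ (properf (- + 4)))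
         (≢-sym (proj₁ (properf (- + 3)))) (proj₂ (properf (- + 3)))
         (adj (+ 0)) (adj (+ 2)) (adj (+ 4)) (adj (+ 1)) (adj (+ 3)) ⟩
  cycleSum (f (+ 0)) (f (- + 2)) (f (- + 4)) (f (- + 1)) (f (- + 3))
    ≡⟨ cycleSum-reverse (f (+ 0)) (f (- + 2)) (f (- + 4)) (f (- + 1)) (f (- + 3)) ⟩
  - cycleSum (f (+ 0)) (f (- + 3)) (f (- + 1)) (f (- + 4)) (f (- + 2))
    -- Three rotations bring the vertex -4 to the front.
    ≡⟨ cong -_ (trans (cycleSum-rotate (f (+ 0)) (f (- + 3)) (f (- + 1)) (f (- + 4)) (f (- + 2)))
         (trans (cycleSum-rotate (f (- + 3)) (f (- + 1)) (f (- + 4)) (f (- + 2)) (f (+ 0)))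
           (cycleSum-rotate (f (- + 1)) (f (- + 4)) (f (- + 2)) (f (+ 0)) (f (- + 3))))) ⟩
  - wind (shiftBy (- + 4) f)
    ≡⟨ cong -_ (wind-shift-4 f properf) ⟩
  - wind f ∎
  where open ≡-Reasoning

-- Translates and free points.

module Δ = GroupProperties Δ-group

-- This is the shift by `invΔ g`, hence a right action: `τ h (τ g x)` is `τ (g ·Δ h) x`.
τ : Δ → 2^Δ → 2^Δ
τ g x h = x (g ·Δ h)

∈B-resp-≐ : ∀ B {x y} → x ≐ y → x ∈B B → y ∈B B
∈B-resp-≐ (cyl h b) x≐y x∈B       = trans (sym (x≐y h)) x∈B
∈B-resp-≐ (compl B) x≐y x∉B       = x∉B ∘ ∈B-resp-≐ B (λ h → sym (x≐y h))
∈B-resp-≐ (union B) x≐y (n , x∈B) = n , ∈B-resp-≐ (B n) x≐y x∈B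

IsAperiodic : 2^Δ → Set
IsAperiodic x = ∀ g → g ≢ eΔ → ¬ (τ g x ≐ x)

free⇒aperiodic : ∀ {x} → IsFree x → IsAperiodic x
free⇒aperiodic {x} free g g≢e fixed = free (invΔ g)
  (λ g⁻¹≡e → g≢e (Δ.⁻¹-injective (trans g⁻¹≡e (sym Δ.ε⁻¹≈ε))))
  (λ h → trans (cong (λ k → x (k ·Δ h)) (Δ.⁻¹-involutive g)) (fixed h))

aperiodic⇒free : ∀ {x} → IsAperiodic x → IsFree x
aperiodic⇒free aper g g≢e = aper (invΔ g) λ g⁻¹≡e → g≢e (Δ.⁻¹-injective (trans g⁻¹≡e (sym Δ.ε⁻¹≈ε)))

-- A period `k` of `τ g x` yields the conjugate period `g k g⁻¹` of `x`.
τ-free : ∀ g {x} → IsFree x → IsFree (τ g x)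
τ-free g {x} free = aperiodic⇒free λ k k≢e fixed → free⇒aperiodic free ((g ·Δ k) ·Δ invΔ g)
  (λ conj≡e → k≢e (Δ.identityʳ-unique g k (Δ.x∙y⁻¹≈ε⇒x≈y (g ·Δ k) g conj≡e)))
  (λ h → let open ≡-Reasoning in begin
    x (((g ·Δ k) ·Δ invΔ g) ·Δ h)  ≡⟨ cong x (·Δ-assoc (g ·Δ k) (invΔ g) h) ⟩
    x ((g ·Δ k) ·Δ (invΔ g ·Δ h))  ≡⟨ cong x (·Δ-assoc g k (invΔ g ·Δ h)) ⟩
    x (g ·Δ (k ·Δ (invΔ g ·Δ h)))  ≡⟨ fixed (invΔ g ·Δ h) ⟩
    x (g ·Δ (invΔ g ·Δ h))         ≡⟨ cong x (Δ.\\-leftDividesˡ g h) ⟩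
    x h                            ∎)

translate : Δ → Free → Free
translate g (x , free) = τ g x , τ-free g free

IsFree-resp-≐ : ∀ {x y} → x ≐ y → IsFree x → IsFree y
IsFree-resp-≐ x≐y free g g≢e fixed =
  free g g≢e λ h → trans (x≐y _) (trans (fixed h) (sym (x≐y h)))

-- The winding number of a 3-colouring along an orbit.

-- An odd power of the generator (0, 1).
flipper : ℕ → Δ
flipper n = 0ℤ , + suc (n ℕ.* 2)

module Colouring (c : Free → Fin 3) (borel : IsBorelMap c) (proper : IsProperColoring c) where

  -- Membership in a Borel code depends only on the values of a point. This replaces function
  -- extensionality and the equality of freeness proofs.
  c-cong : ∀ p q → proj₁ p ≐ proj₁ q → c p ≡ c q
  c-cong p q p≐q = sym (proj₂ (class q) (∈B-resp-≐ (proj₁ (borel (c p))) p≐q (proj₁ (class p) refl)))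
    where class = proj₂ (borel (c p))

  c-step : ∀ p {s} → Gen s → c p ≢ c (translate (invΔ s) p)
  c-step p@(x , free) {s} gen = proper p _
    ((λ x≐sx → free s (gen≢e gen) (λ h → sym (x≐sx h))) , s , gen , λ _ → refl)
    where
    gen≢e : ∀ {s} → Gen s → s ≢ eΔ
    gen≢e g+2 ()
    gen≢e g-2 ()
    gen≢e g+3 ()
    gen≢e g-3 ()
    gen≢e g+t ()
    gen≢e g-t ()

  c-step-· : ∀ p g {s} → Gen s → c (translate g p) ≢ c (translate (g ·Δ invΔ s) p)
  c-step-· p@(x , _) g {s} gen eq = c-step (translate g p) gen
    (trans eq (c-cong (translate (g ·Δ invΔ s) p) (translate (invΔ s) (translate g p))
      (λ h → cong x (·Δ-assoc g (invΔ s) h))))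

  line : Free → ℤ → Fin 3
  line p k = c (translate (k , 0ℤ) p)

  line-proper : ∀ p → Proper (line p)
  -- A step multiplies by the inverse of the generator, so -2 and -3 lead to `k + 2` and `k + 3`.
  line-proper p k = c-step-· p (k , 0ℤ) g-2 , c-step-· p (k , 0ℤ) g-3

  turning : Free → ℤ
  turning p = wind (line p)

  turning≢0 : ∀ p → turning p ≢ 0ℤ
  turning≢0 p = wind≢0 (line p) (line-proper p)

  turning-cong : ∀ p q → proj₁ p ≐ proj₁ q → turning p ≡ turning q
  turning-cong p q p≐q = cycleSum-cong (at (+ 0)) (at (+ 2)) (at (+ 4)) (at (+ 1)) (at (+ 3))
    where
    at : ∀ k → line p k ≡ line q k
    at k = c-cong (translate (k , 0ℤ) p) (translate (k , 0ℤ) q) (λ h → p≐q ((k , 0ℤ) ·Δ h))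

  -- Since (0, 1)(k, 0) = (-k, 0)(0, 1), the generator (0, 1) joins position k of the new line to
  -- position -k of the old one.
  turning-step : ∀ p → turning (translate (0ℤ , 1ℤ) p) ≡ - turning p
  turning-step p@(x , _) = wind-reflect (line p) (line tp) (line-proper p) (line-proper tp) adjacent
    where
    tp = translate (0ℤ , 1ℤ) p
    commute : ∀ k h → (0ℤ , 1ℤ) ·Δ ((k , 0ℤ) ·Δ h) ≡ ((- k , 0ℤ) ·Δ (0ℤ , 1ℤ)) ·Δ h
    commute k h = trans (sym (·Δ-assoc (0ℤ , 1ℤ) (k , 0ℤ) h))
      (cong (λ z → (z , 1ℤ) ·Δ h) (ℤ.+-comm 0ℤ (- k)))
    adjacent : ∀ k → line tp k ≢ line p (- k)
    adjacent k eq = c-step-· p (- k , 0ℤ) g-t (trans (sym eq)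
      (c-cong (translate (k , 0ℤ) tp) (translate ((- k , 0ℤ) ·Δ (0ℤ , 1ℤ)) p) (λ h → cong x (commute k h))))

  turning-flip : ∀ n p → turning (translate (flipper n) p) ≡ - turning p
  turning-flip zero p = turning-step p
  turning-flip (suc n) p@(x , _) = begin
    turning (translate (flipper (suc n)) p)
      ≡⟨ turning-cong (translate (flipper (suc n)) p) (translate (flipper n) (translate t (translate t p)))
           (λ h → cong x (trans (·Δ-assoc t (t ·Δ flipper n) h)
                               (cong (t ·Δ_) (·Δ-assoc t (flipper n) h)))) ⟩
    turning (translate (flipper n) (translate t (translate t p)))
      ≡⟨ turning-flip n (translate t (translate t p)) ⟩
    - turning (translate t (translate t p))
      ≡⟨ cong -_ (trans (turning-step (translate t p)) (cong -_ (turning-step p))) ⟩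
    - - - turning p
      ≡⟨ ℤ.neg-involutive _ ⟩
    - turning p ∎
    where
    open ≡-Reasoning
    t = 0ℤ , 1ℤ

  turning-flip-≢ : ∀ n p → turning (translate (flipper n) p) ≢ turning p
  turning-flip-≢ n p eq = turning≢0 p (self-negative (trans (sym eq) (turning-flip n p)))
    where
    self-negative : ∀ {i} → i ≡ - i → i ≡ 0ℤ
    self-negative {+ zero} _ = refl
    self-negative {+[1+ _ ]} ()
    self-negative { -[1+ _ ]} ()

-- Enumerations of countable sets.

record Enumeration (A : Set) : Set where
  field
    enum       : ℕ → A
    index      : A → ℕ
    enum-index : ∀ a → enum (index a) ≡ a

open Enumeration

nextPair : ℕ × ℕ → ℕ × ℕ
nextPair (zero  , n) = suc n , 0
nextPair (suc m , n) = m , suc n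

unpair : ℕ → ℕ × ℕ
unpair zero    = 0 , 0
unpair (suc k) = nextPair (unpair k)

-- The walk runs through the antidiagonals: (m + 1, 0) comes right after (0, m), and (m, n + 1)
-- right after (m + 1, n).
unpair-surjective : ∀ s m n → m ℕ.+ n ≡ s → ∃ λ k → unpair k ≡ (m , n)
unpair-surjective zero    zero zero refl = 0 , refl
unpair-surjective (suc s) m zero eq with unpair-surjective s 0 s refl
... | k , p rewrite ℕ.+-identityʳ m | eq = suc k , cong nextPair p
unpair-surjective s m (suc n) eq with unpair-surjective s (suc m) n (trans (sym (ℕ.+-suc m n)) eq)
... | k , p = suc k , cong nextPair p

ℕ×ℕ-enumeration : Enumeration (ℕ × ℕ)
ℕ×ℕ-enumeration = record
  { enum       = unpair
  ; index      = λ (m , n) → proj₁ (unpair-surjective _ m n refl)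
  ; enum-index = λ (m , n) → proj₂ (unpair-surjective _ m n refl)
  }

×-enumeration : ∀ {A B} → Enumeration A → Enumeration B → Enumeration (A × B)
×-enumeration A B = record
  { enum       = λ k → enum A (proj₁ (unpair k)) , enum B (proj₂ (unpair k))
  ; index      = λ (a , b) → index ℕ×ℕ-enumeration (index A a , index B b)
  ; enum-index = λ (a , b) → trans
      (cong (λ (m , n) → enum A m , enum B n) (enum-index ℕ×ℕ-enumeration (index A a , index B b)))
      (cong₂ _,_ (enum-index A a) (enum-index B b))
  }

Bool-enumeration : Enumeration Bool
Bool-enumeration = record
  { enum       = λ { zero → false ; (suc _) → true }
  ; index      = λ { false → 0 ; true → 1 }
  ; enum-index = λ { false → refl ; true → refl }
  }

ℤ-enumeration : Enumeration ℤ
ℤ-enumeration = record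
  { enum       = signed ∘ unpair
  ; index      = index ℕ×ℕ-enumeration ∘ code
  ; enum-index = λ i → trans (cong signed (enum-index ℕ×ℕ-enumeration (code i))) (signed-code i)
  }
  where
  signed : ℕ × ℕ → ℤ
  signed (zero  , n) = + n
  signed (suc _ , n) = -[1+ n ]
  code : ℤ → ℕ × ℕ
  code (+ n)    = 0 , n
  code -[1+ n ] = 1 , n
  signed-code : ∀ i → signed (code i) ≡ i
  signed-code (+ n)    = refl
  signed-code -[1+ n ] = refl

abstract
  Δ-enumeration : Enumeration Δ
  Δ-enumeration = ×-enumeration ℤ-enumeration ℤ-enumeration

List-enumeration : ∀ {A} → Enumeration A → Enumeration (List A)
List-enumeration {A} enumA = record
  -- The length is stored separately, because the nested pairs do not show where the list ends.
  { enum       = λ k → decode (proj₁ (unpair k)) (proj₂ (unpair k))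
  ; index      = λ as → index ℕ×ℕ-enumeration (length as , encode as)
  ; enum-index = λ as → trans
      (cong (λ (l , n) → decode l n) (enum-index ℕ×ℕ-enumeration (length as , encode as)))
      (decode-encode as)
  }
  where
  decode : ℕ → ℕ → List A
  decode zero    n = []
  decode (suc l) n = enum enumA (proj₁ (unpair n)) ∷ decode l (proj₂ (unpair n))
  encode : List A → ℕ
  encode []       = 0
  encode (a ∷ as) = index ℕ×ℕ-enumeration (index enumA a , encode as)
  decode-encode : ∀ as → decode (length as) (encode as) ≡ as
  decode-encode []       = refl
  decode-encode (a ∷ as)
    rewrite enum-index ℕ×ℕ-enumeration (index enumA a , encode as) =
    cong₂ _∷_ (enum-index enumA a) (decode-encode as)

-- Finite conditions and their extensions.

-- A finite partial function Δ ⇀ Bool; the first matching entry wins, so that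
-- every p ++ r extends p.
Condition : Set
Condition = List (Δ × Bool)

_≟Δ_ : DecidableEquality Δ
_≟Δ_ = ≡-dec ℤ._≟_ ℤ._≟_

lookup : Condition → Δ → Maybe Bool
lookup []            h = nothing
lookup ((k , b) ∷ p) h with k ≟Δ h
... | yes _ = just b
... | no  _ = lookup p h

lookup-here : ∀ h b p → lookup ((h , b) ∷ p) h ≡ just b
lookup-here h b p with h ≟Δ h
... | yes _  = refl
... | no h≢h = contradiction refl h≢h

lookup-there : ∀ {h k} b p → k ≢ h → lookup ((k , b) ∷ p) h ≡ lookup p h
lookup-there {h} {k} b p k≢h with k ≟Δ h
... | yes k≡h = contradiction k≡h k≢h
... | no  _   = refl

lookup-++ : ∀ p q h → lookup (p ++ q) h ≡ (lookup p h <∣> lookup q h)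
lookup-++ []            q h = refl
lookup-++ ((k , b) ∷ p) q h with k ≟Δ h
... | yes _ = refl
... | no  _ = lookup-++ p q h

lookup-++ˡ : ∀ p q {h b} → lookup p h ≡ just b → lookup (p ++ q) h ≡ just b
lookup-++ˡ p q {h} eq = trans (lookup-++ p q h) (cong (λ m → m <∣> lookup q h) eq)

lookup-++ʳ : ∀ p q {h} → lookup p h ≡ nothing → lookup (p ++ q) h ≡ lookup q h
lookup-++ʳ p q {h} eq = trans (lookup-++ p q h) (cong (λ m → m <∣> lookup q h) eq)

data _≼_ (p : Condition) : Condition → Set where
  extended : ∀ r → p ≼ (p ++ r)

≼-refl : ∀ {p} → p ≼ p
≼-refl {p} = subst (p ≼_) (List.++-identityʳ p) (extended [])

≼-trans : ∀ {p q s} → p ≼ q → q ≼ s → p ≼ s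
≼-trans {p} (extended r) (extended r′) = subst (p ≼_) (sym (List.++-assoc p r r′)) (extended (r ++ r′))

lookup-≼ : ∀ {p q h b} → p ≼ q → lookup p h ≡ just b → lookup q h ≡ just b
lookup-≼ {p} (extended r) eq = lookup-++ˡ p r eq

≼-chain : (f : ℕ → Condition) → (∀ n → f n ≼ f (suc n)) → ∀ {m n} → m ≤ n → f m ≼ f n
≼-chain f step m≤n = go (ℕ.≤⇒≤′ m≤n)
  where
  go : ∀ {m n} → m ℕ.≤′ n → f m ≼ f n
  go ℕ.≤′-refl           = ≼-refl
  go (ℕ.≤′-step {n} m≤n) = ≼-trans (go m≤n) (step n)

record _⊂_ (p : Condition) (x : 2^Δ) : Set where
  constructor agreeing
  field agrees : ∀ {h b} → lookup p h ≡ just b → x h ≡ b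

open _⊂_

⊂-≼ : ∀ {p q x} → p ≼ q → q ⊂ x → p ⊂ x
⊂-≼ p≼q q⊂x = agreeing (agrees q⊂x ∘ lookup-≼ p≼q)

move : Δ → Condition → Condition
move g = map (map₁ (g ·Δ_))

lookup-move : ∀ g p h → lookup (move g p) (g ·Δ h) ≡ lookup p h
lookup-move g []            h = refl
lookup-move g ((k , b) ∷ p) h with k ≟Δ h
... | yes refl = lookup-here (g ·Δ k) b (move g p)
... | no  k≢h  = trans (lookup-there b (move g p) (k≢h ∘ Δ.∙-cancelˡ g k h)) (lookup-move g p h)

height : Condition → ℕ
height []                  = 0
height (((_ , m) , _) ∷ p) = ∣ m ∣ ⊔ height p

lookup-height : ∀ p h {b} → lookup p h ≡ just b → ∣ proj₂ h ∣ ≤ height p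
lookup-height ((k , b) ∷ p) h eq with k ≟Δ h
... | yes refl = ℕ.m≤m⊔n _ _
... | no  _    = ℕ.m≤n⇒m≤o⊔n _ (lookup-height p h eq)

lookup-above-height : ∀ p h → height p < ∣ proj₂ h ∣ → lookup p h ≡ nothing
lookup-above-height p h above with lookup p h in eq
... | just b  = contradiction (lookup-height p h eq) (ℕ.<⇒≱ above)
... | nothing = refl

∣i∣≤∣i+j∣+∣j∣ : ∀ i j → ∣ i ∣ ≤ ∣ i + j ∣ ℕ.+ ∣ j ∣
∣i∣≤∣i+j∣+∣j∣ i j = begin
  ∣ i ∣                     ≡⟨ cong ∣_∣ (cancel i j) ⟩
  ∣ i + j + - j ∣           ≤⟨ ℤ.∣i+j∣≤∣i∣+∣j∣ (i + j) (- j) ⟩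
  ∣ i + j ∣ ℕ.+ ∣ - j ∣     ≡⟨ cong (∣ i + j ∣ ℕ.+_) (ℤ.∣-i∣≡∣i∣ j) ⟩
  ∣ i + j ∣ ℕ.+ ∣ j ∣       ∎
  where
  open ℕ.≤-Reasoning
  cancel : ∀ i j → i ≡ i + j + - j
  cancel = solve-∀

double : Condition → Condition
double p = p ++ move (flipper (height p)) p

-- The second coordinates in `p` are at most its height H in absolute value; adding 2H + 1 lifts
-- them above H. So the copy lies outside the domain of `p` and is not masked by it.
double-recurs : ∀ p {x} → double p ⊂ x → ∀ h {b} → lookup p h ≡ just b → x (flipper (height p) ·Δ h) ≡ b
double-recurs p ⊂x h eq = agrees ⊂x
  (trans (lookup-++ʳ p (move γ p) (lookup-above-height p (γ ·Δ h) above)) (trans (lookup-move γ p h) eq))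
  where
  γ = flipper (height p)
  above : height p < ∣ proj₂ (γ ·Δ h) ∣
  above = ℕ.+-cancelʳ-≤ (height p) _ _ (begin
    suc (height p) ℕ.+ height p                           ≡⟨ cong (λ k → suc (height p ℕ.+ k)) (ℕ.+-identityʳ _) ⟨
    suc (2 ℕ.* height p)                                  ≡⟨ cong suc (ℕ.*-comm 2 (height p)) ⟩
    ∣ proj₂ γ ∣                                           ≤⟨ ∣i∣≤∣i+j∣+∣j∣ (proj₂ γ) (proj₂ h) ⟩
    ∣ proj₂ (γ ·Δ h) ∣ ℕ.+ ∣ proj₂ h ∣                    ≤⟨ ℕ.+-monoʳ-≤ _ (lookup-height p h eq) ⟩
    ∣ proj₂ (γ ·Δ h) ∣ ℕ.+ height p                       ∎)
    where open ℕ.≤-Reasoning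

separate : Δ → Condition → Condition
separate g p = p ++ (h , true) ∷ (g ·Δ h , false) ∷ []
  -- High enough that both `h` and `g ·Δ h` lie above the height of `p`.
  where h = 0ℤ , + (suc (height p) ℕ.+ ∣ proj₂ g ∣)

-- Opposite values at the two fresh sites break the period `g`. The sites differ because `g` is not
-- the identity, so the first entry does not mask the second.
separate-aperiodic : ∀ g p {x} → separate g p ⊂ x → g ≢ eΔ → ¬ (τ g x ≐ x)
separate-aperiodic g p {x} ⊂x g≢e fixed = case trans (sym xgh) (trans (fixed h) xh) of λ ()
  where
  K = suc (height p) ℕ.+ ∣ proj₂ g ∣
  h : Δ
  h = 0ℤ , + K
  entries = (h , true) ∷ (g ·Δ h , false) ∷ []
  xh : x h ≡ true
  xh = agrees ⊂x (trans (lookup-++ʳ p entries (lookup-above-height p h (ℕ.m≤m+n _ _))) (lookup-here h true _))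
  h≢gh : h ≢ g ·Δ h
  h≢gh eq = g≢e (Δ.identityˡ-unique g h (sym eq))
  above : height p < ∣ proj₂ (g ·Δ h) ∣
  above = ℕ.+-cancelʳ-≤ ∣ proj₂ g ∣ _ _ (begin
    K                                          ≤⟨ ∣i∣≤∣i+j∣+∣j∣ (+ K) (proj₂ g) ⟩
    ∣ + K + proj₂ g ∣ ℕ.+ ∣ proj₂ g ∣          ≡⟨ cong (λ z → ∣ z ∣ ℕ.+ ∣ proj₂ g ∣) (ℤ.+-comm (+ K) (proj₂ g)) ⟩
    ∣ proj₂ (g ·Δ h) ∣ ℕ.+ ∣ proj₂ g ∣         ∎)
    where open ℕ.≤-Reasoning
  xgh : x (g ·Δ h) ≡ false
  xgh = agrees ⊂x (trans (lookup-++ʳ p entries (lookup-above-height p (g ·Δ h) above))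
    (trans (lookup-there true _ h≢gh) (lookup-here (g ·Δ h) false [])))

-- The first match wins, so the default `false` takes effect only if `p` has no value at `g`.
base : Δ → Condition → Condition
base g p = separate g (p ++ (g , false) ∷ [])

-- Doubling comes last, so that the copy carries the value at `g` too.
extend : Δ → Condition → Condition
extend g p = double (base g p)

≼-base : ∀ g p → p ≼ base g p
≼-base g p = ≼-trans (extended _) (extended _)

base-≼-extend : ∀ g p → base g p ≼ extend g p
base-≼-extend g p = extended _

≼-extend : ∀ g p → p ≼ extend g p
≼-extend g p = ≼-trans (≼-base g p) (base-≼-extend g p)

base-determines : ∀ h p → ∃ λ b → lookup (base h p) h ≡ just b
base-determines h p with lookup p h in eq
... | just b  = b , lookup-++ˡ (p ++ (h , false) ∷ []) _ (lookup-++ˡ p _ eq)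
... | nothing = false , lookup-++ˡ (p ++ (h , false) ∷ []) _ (trans (lookup-++ʳ p _ eq) (lookup-here h false []))

-- The separating entries in `extend g p` exclude the period `g`. Freeness is a negative statement,
-- so a doubly negated existence suffices.
free-from-extensions : ∀ {x} → (∀ g → ¬ ¬ ∃ λ p → extend g p ⊂ x) → IsFree x
free-from-extensions ext = aperiodic⇒free λ g g≢e fixed → ext g λ (p , ⊂x) →
  separate-aperiodic g _ (⊂-≼ (base-≼-extend g p) ⊂x) g≢e fixed

-- An explicit recurrent free point.

gₙ : ℕ → Δ
gₙ = enum Δ-enumeration

indexΔ : Δ → ℕ
indexΔ = index Δ-enumeration

chain : ℕ → Condition
chain zero    = []
chain (suc n) = extend (gₙ n) (chain n)

chain-mono : ∀ {m n} → m ≤ n → chain m ≼ chain n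
chain-mono = ≼-chain chain (λ n → ≼-extend (gₙ n) (chain n))

base-chain-determines : ∀ h → ∃ λ b → lookup (base (gₙ (indexΔ h)) (chain (indexΔ h))) h ≡ just b
base-chain-determines h = subst (λ g → ∃ λ b → lookup (base g (chain (indexΔ h))) h ≡ just b)
  (sym (enum-index Δ-enumeration h)) (base-determines h (chain (indexΔ h)))

recurrent : 2^Δ
recurrent h = proj₁ (base-chain-determines h)

recurrent-lookup : ∀ h → lookup (chain (suc (indexΔ h))) h ≡ just (recurrent h)
recurrent-lookup h = lookup-≼ (base-≼-extend (gₙ (indexΔ h)) (chain (indexΔ h))) (proj₂ (base-chain-determines h))

chain⊂recurrent : ∀ n → chain n ⊂ recurrent
chain⊂recurrent n = agreeing λ {h} eq → [ below h eq , above h eq ]′ (ℕ.≤-total n (suc (indexΔ h)))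
  where
  below : ∀ h {b} → lookup (chain n) h ≡ just b → n ≤ suc (indexΔ h) → recurrent h ≡ b
  below h eq n≤m = Maybe.just-injective (trans (sym (recurrent-lookup h)) (lookup-≼ (chain-mono n≤m) eq))
  above : ∀ h {b} → lookup (chain n) h ≡ just b → suc (indexΔ h) ≤ n → recurrent h ≡ b
  above h eq m≤n = Maybe.just-injective (trans (sym (lookup-≼ (chain-mono m≤n) (recurrent-lookup h))) eq)

recurrent-free : IsFree recurrent
recurrent-free = free-from-extensions λ g none → none (chain (indexΔ g) ,
  subst (λ k → extend k (chain (indexΔ g)) ⊂ recurrent) (enum-index Δ-enumeration g)
    (chain⊂recurrent (suc (indexΔ g))))

returnTime : ℕ → ℕ
returnTime n = height (base (gₙ n) (chain n))

-- The condition doubled at stage `n` has values at all sites of index at most `n`; `base` has just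
-- supplied the one at index `n`.
recurrent-recurs : ∀ n h → indexΔ h ≤ n → recurrent (flipper (returnTime n) ·Δ h) ≡ recurrent h
recurrent-recurs n h i≤n = double-recurs (base (gₙ n) (chain n)) (chain⊂recurrent (suc n)) h known
  where
  known : lookup (base (gₙ n) (chain n)) h ≡ just (recurrent h)
  known with ℕ.m≤n⇒m<n∨m≡n i≤n
  ... | inj₁ i<n  = lookup-≼ (≼-trans (chain-mono i<n) (≼-base (gₙ n) (chain n))) (recurrent-lookup h)
  ... | inj₂ refl = proj₂ (base-chain-determines h)

-- WLPO from a Borel 3-colouring.

WLPO : Set
WLPO = (α : ℕ → Bool) → Dec (∀ n → α n ≡ false)

module _ (α : ℕ → Bool) where

  hit : ℕ → Maybe ℕ
  hit n = if α n then just n else nothing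

  firstHit : ℕ → Maybe ℕ
  firstHit zero    = hit zero
  firstHit (suc n) = firstHit n <∣> hit (suc n)

  firstHit-none : (∀ n → α n ≡ false) → ∀ n → firstHit n ≡ nothing
  firstHit-none none zero    rewrite none 0 = refl
  firstHit-none none (suc n) rewrite firstHit-none none n | none (suc n) = refl

  firstHit-some : ∀ n → α n ≡ true → ∃ λ m → firstHit n ≡ just m
  firstHit-some zero    eq rewrite eq = 0 , refl
  firstHit-some (suc n) eq with firstHit n
  ... | just m  = m , refl
  ... | nothing rewrite eq = suc n , refl

  firstHit-suc : ∀ {n m} → firstHit n ≡ just m → firstHit (suc n) ≡ just m
  firstHit-suc {n} eq rewrite eq = refl

  firstHit-mono : ∀ {n N m} → n ≤ N → firstHit n ≡ just m → firstHit N ≡ just m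
  firstHit-mono n≤N eq = go (ℕ.≤⇒≤′ n≤N)
    where
    go : ∀ {N} → _ ℕ.≤′ N → firstHit N ≡ just _
    go ℕ.≤′-refl       = eq
    go (ℕ.≤′-step n≤N) = firstHit-suc (go n≤N)

  firstHit-≤ : ∀ n {m} → firstHit n ≡ just m → α m ≡ true × m ≤ n
  firstHit-≤ zero eq with α 0 in α0
  firstHit-≤ zero refl | true = α0 , ℕ.z≤n
  firstHit-≤ (suc n) eq with firstHit n in eq′ | α (suc n) in αn
  firstHit-≤ (suc n) refl | just m  | _    = map₂ ℕ.m≤n⇒m≤1+n (firstHit-≤ n eq′)
  firstHit-≤ (suc n) refl | nothing | true = αn , ℕ.≤-refl

  firstHit-unique : ∀ n {m} → firstHit n ≡ just m → ∀ N → firstHit N ≡ just m ⊎ (firstHit N ≡ nothing × N < m)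
  firstHit-unique n {m} eq N with firstHit N in eqN
  ... | just m′ = inj₁ (trans (sym eqN) (case ℕ.≤-total n N of λ
    { (inj₁ n≤N) → firstHit-mono n≤N eq
    ; (inj₂ N≤n) → trans eqN (trans (sym (firstHit-mono N≤n eqN)) eq) }))
  ... | nothing = inj₂ (refl , ℕ.≰⇒> λ m≤N → let m′ , eq′ = firstHit-some m (proj₁ (firstHit-≤ n eq)) in
    case trans (sym (firstHit-mono m≤N eq′)) eqN of λ ())

  -- Each site consults `α` only up to its own index, so the point is defined without knowing
  -- whether `α` vanishes.
  interpolant : 2^Δ
  interpolant h = maybe (λ n → recurrent (flipper (returnTime n) ·Δ h)) (recurrent h) (firstHit (indexΔ h))

  interpolant-none : (∀ n → α n ≡ false) → recurrent ≐ interpolant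
  interpolant-none none h rewrite firstHit-none none (indexΔ h) = refl

  -- If `m` is the first hit, sites of index below `m` keep the value of `recurrent`, but there the
  -- translate chosen at `m` has the same value.
  interpolant-some : ∀ n → α n ≡ true → ∃ λ m → τ (flipper m) recurrent ≐ interpolant
  interpolant-some n αn with firstHit-some n αn
  ... | m , eq = returnTime m , agree
    where
    agree : ∀ h → τ (flipper (returnTime m)) recurrent h ≡ interpolant h
    agree h with firstHit (indexΔ h) | firstHit-unique n eq (indexΔ h)
    ... | _ | inj₁ refl         = refl
    ... | _ | inj₂ (refl , i<m) = recurrent-recurs m h (ℕ.<⇒≤ i<m)

  -- A period refutes every hit of `α`, because translates of `recurrent` are free; then the point
  -- is `recurrent` itself, which is free as well.
  interpolant-free : IsFree interpolant
  interpolant-free g g≢e fixed = IsFree-resp-≐ (interpolant-none none) recurrent-free g g≢e fixed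
    where
    none : ∀ n → α n ≡ false
    none n = Bool.¬-not λ αn → let m , eq = interpolant-some n αn in
      IsFree-resp-≐ eq (τ-free (flipper m) recurrent-free) g g≢e fixed

module WLPO-from-colouring (c : Free → Fin 3) (borel : IsBorelMap c) (proper : IsProperColoring c) where
  open Colouring c borel proper

  base-point : Free
  base-point = recurrent , recurrent-free

  interpolated : (ℕ → Bool) → Free
  interpolated α = interpolant α , interpolant-free α

  same⇒none : ∀ α → turning (interpolated α) ≡ turning base-point → ∀ n → α n ≡ false
  same⇒none α same n = Bool.¬-not λ αn → let m , eq = interpolant-some α n αn in
    turning-flip-≢ m base-point (trans (turning-cong (translate (flipper m) base-point) (interpolated α) eq) same)

  none⇒same : ∀ α → (∀ n → α n ≡ false) → turning (interpolated α) ≡ turning base-point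
  none⇒same α none = sym (turning-cong base-point (interpolated α) (interpolant-none α none))

  wlpo : WLPO
  wlpo α = map′ (same⇒none α) (none⇒same α) (turning (interpolated α) ℤ.≟ turning base-point)

-- The forcing relation and its truth lemma.

Fin3-enumeration : Enumeration (Fin 3)
Fin3-enumeration = record
  { enum       = λ { 0 → zero ; 1 → suc zero ; _ → suc (suc zero) }
  ; index      = λ { zero → 0 ; (suc zero) → 1 ; (suc (suc zero)) → 2 }
  ; enum-index = λ { zero → refl ; (suc zero) → refl ; (suc (suc zero)) → refl }
  }

abstract
  Condition-enumeration : Enumeration Condition
  Condition-enumeration = List-enumeration (×-enumeration Δ-enumeration Bool-enumeration)

-- A strong forcing relation; g records the translate of the generic point
-- that the forced statement is about.  Unions are forced in the double-negated sense, which
-- is what WLPO can decide without Markov's principle.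
_⊩[_]_ : Condition → Δ → BorelCode → Set
p ⊩[ g ] cyl h b = lookup p (g ·Δ h) ≡ just b
p ⊩[ g ] compl B = ∀ r → ¬ ((p ++ r) ⊩[ g ] B)
p ⊩[ g ] union B = ¬ (∀ n → ¬ (p ⊩[ g ] B n))

⊩-++ : ∀ B {g} p r → p ⊩[ g ] B → (p ++ r) ⊩[ g ] B
⊩-++ (cyl h b) p r ⊩B = lookup-++ˡ p r ⊩B
⊩-++ (compl B) {g} p r ⊩¬B s ⊩B = ⊩¬B (r ++ s) (subst (_⊩[ g ] B) (List.++-assoc p r s) ⊩B)
⊩-++ (union B) p r ⊩B none = ⊩B λ n ⊩Bn → none n (⊩-++ (B n) p r ⊩Bn)

⊩-≼ : ∀ B {g p q} → p ≼ q → p ⊩[ g ] B → q ⊩[ g ] B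
⊩-≼ B {p = p} (extended r) = ⊩-++ B p r

_≈_ : Condition → Condition → Set
p ≈ q = ∀ h → lookup p h ≡ lookup q h

++-congˡ : ∀ p q r → p ≈ q → (p ++ r) ≈ (q ++ r)
++-congˡ p q r p≈q h = trans (lookup-++ p r h) (trans (cong (_<∣> lookup r h) (p≈q h)) (sym (lookup-++ q r h)))

⊩-resp-≈ : ∀ B {g} p q → p ≈ q → p ⊩[ g ] B → q ⊩[ g ] B
⊩-resp-≈ (cyl h b) {g} p q p≈q ⊩B = trans (sym (p≈q (g ·Δ h))) ⊩B
⊩-resp-≈ (compl B) p q p≈q ⊩¬B r ⊩B =
  ⊩¬B r (⊩-resp-≈ B (q ++ r) (p ++ r) (++-congˡ q p r (λ h → sym (p≈q h))) ⊩B)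
⊩-resp-≈ (union B) p q p≈q ⊩B none = ⊩B λ n ⊩Bn → none n (⊩-resp-≈ (B n) p q p≈q ⊩Bn)

move-inverse : ∀ g p → move (invΔ g) (move g p) ≡ p
move-inverse g []            = refl
move-inverse g ((h , b) ∷ p) = cong₂ _∷_ (cong (_, b) (Δ.\\-leftDividesʳ g h)) (move-inverse g p)

-- Left multiplication is an automorphism of the conditions; an extension of the moved condition
-- pulls back along `invΔ k`.
⊩-move : ∀ B k {g} p → p ⊩[ g ] B → move k p ⊩[ k ·Δ g ] B
⊩-move (cyl h b) k {g} p ⊩B =
  trans (cong (lookup (move k p)) (·Δ-assoc k g h)) (trans (lookup-move k p (g ·Δ h)) ⊩B)
⊩-move (compl B) k {g} p ⊩¬B r ⊩B = ⊩¬B (move (invΔ k) r)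
  (subst₂ (_⊩[_] B)
    (trans (List.map-++ _ (move k p) r) (cong (_++ move (invΔ k) r) (move-inverse k p)))
    (Δ.\\-leftDividesʳ k g)
    (⊩-move B (invΔ k) (move k p ++ r) ⊩B))
⊩-move (union B) k p ⊩B none = ⊩B λ n ⊩Bn → none n (⊩-move (B n) k p ⊩Bn)

⊂-compatible : ∀ p q {x} → p ⊂ x → q ⊂ x → (p ++ q) ≈ (q ++ p)
⊂-compatible p q p⊂x q⊂x h rewrite lookup-++ p q h | lookup-++ q p h
  with lookup p h in eqp | lookup q h in eqq
... | just _  | just _  = cong just (trans (sym (agrees p⊂x eqp)) (agrees q⊂x eqq))
... | just _  | nothing = refl
... | nothing | just _  = refl
... | nothing | nothing = refl

-- Both conditions agree with `x`, so `p ++ q` and `q ++ p` are the same partial function, which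
-- would force `B` and its complement.
⊩-consistent : ∀ B {g} p q {x} → p ⊂ x → q ⊂ x → p ⊩[ g ] B → ¬ (q ⊩[ g ] compl B)
⊩-consistent B p q p⊂x q⊂x ⊩B ⊩¬B =
  ⊩¬B p (⊩-resp-≈ B (p ++ q) (q ++ p) (⊂-compatible p q p⊂x q⊂x) (⊩-++ B p q ⊩B))

Decides : Condition → Δ → BorelCode → Set
Decides p g B = p ⊩[ g ] B ⊎ p ⊩[ g ] compl B

Decides-dense : ∀ g B p → ¬ ¬ ∃ λ r → Decides (p ++ r) g B
-- If no extension forces `B`, then `p` itself, extended by nothing, forces the complement.
Decides-dense g B p none = none ([] ,
  subst (λ q → Decides q g B) (sym (List.++-identityʳ p)) (inj₂ λ r ⊩B → none (r , inj₁ ⊩B)))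

-- The truth lemma needs decisions on all hereditary subcodes; numbering them makes these countably
-- many requirements.
subcode : BorelCode → ℕ → BorelCode
subcode B         zero    = B
subcode (cyl h b) (suc k) = cyl h b
subcode (compl B) (suc k) = subcode B k
subcode (union B) (suc k) = subcode (B (proj₁ (unpair k))) (proj₂ (unpair k))

Decided : 2^Δ → Δ → BorelCode → Set
Decided x g B = ¬ ¬ ∃ λ p → p ⊂ x × Decides p g B

AllDecided : 2^Δ → BorelCode → Set
AllDecided x B = ∀ g k → Decided x g (subcode B k)

AllDecided-union : ∀ {x} B → AllDecided x (union B) → ∀ n → AllDecided x (B n)
AllDecided-union {x} B all n g k = subst (Decided x g)
  (cong (λ (m , j) → subcode (B m) j) (enum-index ℕ×ℕ-enumeration (n , k)))
  (all g (suc (index ℕ×ℕ-enumeration (n , k))))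

-- Simultaneous induction on the code. The conclusion is doubly negated because a forced union
-- provides no index.
⊩-sound : ∀ B {x g} p → AllDecided x B → p ⊂ x → p ⊩[ g ] B → ¬ ¬ (τ g x ∈B B)
⊩-compl-sound : ∀ B {x g} p → AllDecided x B → p ⊂ x → p ⊩[ g ] compl B → ¬ (τ g x ∈B B)

⊩-sound (cyl h b) p all p⊂x ⊩B x∉B = x∉B (agrees p⊂x ⊩B)
⊩-sound (compl B) p all p⊂x ⊩¬B x∉¬B = x∉¬B (⊩-compl-sound B p (λ g k → all g (suc k)) p⊂x ⊩¬B)
⊩-sound (union B) p all p⊂x ⊩B x∉B =
  ⊩B λ n ⊩Bn → ⊩-sound (B n) p (AllDecided-union B all n) p⊂x ⊩Bn λ x∈Bn → x∉B (n , x∈Bn)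

-- If `x` lies in the cylinder, then `p` already has the value `b` at the site or can be extended by
-- it, and so some extension forces the cylinder.
⊩-compl-sound (cyl h b) {x} {g} p all p⊂x ⊩¬B x∈B with lookup p (g ·Δ h) in eq
... | just b′ = ⊩¬B [] (trans (lookup-++ˡ p [] eq) (cong just (trans (sym (agrees p⊂x eq)) x∈B)))
... | nothing = ⊩¬B ((g ·Δ h , b) ∷ []) (trans (lookup-++ʳ p _ eq) (lookup-here (g ·Δ h) b []))
-- The subcode of `compl B` with number 1 is `B`; either decision about it is contradictory.
⊩-compl-sound (compl B) {g = g} p all p⊂x ⊩¬¬B x∉B = all g 1 λ
  { (q , q⊂x , inj₁ ⊩B)  → ⊩-sound B q (λ g k → all g (suc k)) q⊂x ⊩B x∉B
  ; (q , q⊂x , inj₂ ⊩¬B) → ⊩-consistent (compl B) q p q⊂x p⊂x ⊩¬B ⊩¬¬B }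
⊩-compl-sound (union B) {g = g} p all p⊂x ⊩¬B (n , x∈Bn) = AllDecided-union B all n g 0 λ
  { (q , q⊂x , inj₁ ⊩Bn)  → ⊩-consistent (union B) q p q⊂x p⊂x (λ none → none n ⊩Bn) ⊩¬B
  ; (q , q⊂x , inj₂ ⊩¬Bn) → ⊩-compl-sound (B n) q (AllDecided-union B all n) q⊂x ⊩¬Bn x∈Bn }

-- The generic point under WLPO.

module Omniscience (wlpo : WLPO) where

  ∀-dec : {A : Set} {P : A → Set} → Enumeration A → (∀ (a : A) → Dec (P a)) → Dec (∀ a → P a)
  ∀-dec {P = P} E P? = map′ to from (wlpo λ n → not (does (P? (enum E n))))
    where
    to : (∀ n → not (does (P? (enum E n))) ≡ false) → ∀ a → P a
    to none a = subst P (enum-index E a) (holds (index E a) (none (index E a)))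
      where
      holds : ∀ n → not (does (P? (enum E n))) ≡ false → P (enum E n)
      holds n eq with P? (enum E n)
      ... | yes Pa = Pa
    from : (∀ a → P a) → ∀ n → not (does (P? (enum E n))) ≡ false
    from all n with P? (enum E n)
    ... | yes _  = refl
    ... | no ¬Pa = contradiction (all _) ¬Pa

  ℕ-enumeration : Enumeration ℕ
  ℕ-enumeration = record { enum = λ n → n ; index = λ n → n ; enum-index = λ _ → refl }

  -- Every quantifier in the definition of forcing is universal over an enumerated set, so WLPO
  -- decides it.
  _⊩[_]?_ : ∀ p g B → Dec (p ⊩[ g ] B)
  p ⊩[ g ]? cyl h b = Maybe.≡-dec Bool._≟_ (lookup p (g ·Δ h)) (just b)
  p ⊩[ g ]? compl B = ∀-dec Condition-enumeration λ r → ¬? ((p ++ r) ⊩[ g ]? B)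
  p ⊩[ g ]? union B = ¬? (∀-dec ℕ-enumeration λ n → ¬? (p ⊩[ g ]? B n))

  Decides? : ∀ p g B → Dec (Decides p g B)
  Decides? p g B = (p ⊩[ g ]? B) ⊎-dec (p ⊩[ g ]? compl B)

  module GenericPoint
    (D : ℕ → Condition → Set) (D? : ∀ k p → Dec (D k p))
    (dense : ∀ k p → ¬ ¬ ∃ λ r → D k (p ++ r))
    where

    -- (q , k , m): an extension q ++ r in the k-th dense set is sought, and the r with index
    -- below m have been ruled out.
    State : Set
    State = Condition × ℕ × ℕ

    candidate : Condition → ℕ → Condition
    candidate q m = q ++ enum Condition-enumeration m

    branch : Bool → State → State
    branch true  (q , k , m) = extend (gₙ k) (candidate q m) , suc k , 0
    branch false (q , k , m) = q , k , suc m

    -- Testing one candidate per step keeps the construction total: density holds only up to double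
    -- negation and gives no bound on the search.
    step : State → State
    step s@(q , k , m) = branch (does (D? k (candidate q m))) s

    state : ℕ → State
    state zero    = [] , 0 , 0
    state (suc n) = step (state n)

    approx : ℕ → Condition
    approx = proj₁ ∘ state

    target : ℕ → ℕ
    target = proj₁ ∘ proj₂ ∘ state

    approx-mono : ∀ {m n} → m ≤ n → approx m ≼ approx n
    approx-mono = ≼-chain approx λ n → step-≼ (state n)
      where
      step-≼ : ∀ s → proj₁ s ≼ proj₁ (step s)
      step-≼ (q , k , m) with does (D? k (candidate q m))
      ... | true  = ≼-trans (extended _) (≼-extend (gₙ k) (candidate q m))
      ... | false = ≼-refl

    target-mono : ∀ {m n} → m ≤ n → target m ≤ target n
    target-mono m≤n = go (ℕ.≤⇒≤′ m≤n)
      where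
      step-≤ : ∀ s → proj₁ (proj₂ s) ≤ proj₁ (proj₂ (step s))
      step-≤ (q , k , m) with does (D? k (candidate q m))
      ... | true  = ℕ.n≤1+n k
      ... | false = ℕ.≤-refl
      go : ∀ {m n} → m ℕ.≤′ n → target m ≤ target n
      go ℕ.≤′-refl           = ℕ.≤-refl
      go (ℕ.≤′-step {n} m≤n) = ℕ.≤-trans (go m≤n) (step-≤ (state n))

    -- `j` is the distance from the current candidate to one known to succeed, and so bounds the
    -- remaining steps; the search may stop earlier.
    search : ∀ j n q k m → state n ≡ (q , k , m) → D k (candidate q (j ℕ.+ m)) →
      ∃₂ λ n′ r → D k (q ++ r) × state n′ ≡ (extend (gₙ k) (q ++ r) , suc k , 0)
    search j n q k m eq Dj with D? k (candidate q m) in decision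
    ... | yes Dm = suc n , _ , Dm ,
      trans (cong step eq) (cong (λ d → branch (does d) (q , k , m)) decision)
    search zero    n q k m eq Dj | no ¬Dm = contradiction Dj ¬Dm
    search (suc j) n q k m eq Dj | no ¬Dm = search j (suc n) q k (suc m)
      (trans (cong step eq) (cong (λ d → branch (does d) (q , k , m)) decision))
      (subst (D k ∘ candidate q) (sym (ℕ.+-suc j m)) Dj)

    progress : ∀ n q k → state n ≡ (q , k , 0) →
      ¬ ¬ ∃₂ λ n′ r → D k (q ++ r) × state n′ ≡ (extend (gₙ k) (q ++ r) , suc k , 0)
    progress n q k eq none = dense k q λ (r , Dr) → 
      let i = index Condition-enumeration r
          r≡ = trans (cong (enum Condition-enumeration) (ℕ.+-identityʳ i)) (enum-index Condition-enumeration r)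
      in none (search i n q k 0 eq (subst (λ s → D k (q ++ s)) (sym r≡) Dr))

    reach : ∀ k → ¬ ¬ ∃₂ λ n q → state n ≡ (q , k , 0)
    reach zero    none = none (0 , [] , refl)
    reach (suc k) none = reach k λ (n , q , eq) → progress n q k eq λ (n′ , r , _ , eq′) → none (n′ , _ , eq′)

    meets : ∀ k → ¬ ¬ ∃₂ λ n q → D k q × approx n ≡ extend (gₙ k) q
    meets k none = reach k λ (n , q , eq) → progress n q k eq λ (n′ , r , Dr , eq′) →
      none (n′ , q ++ r , Dr , cong proj₁ eq′)

    -- A dense set numbered above `target j` is treated only after time `j`, so the condition
    -- extended there already extends `approx j`.
    returns : ∀ j → ¬ ¬ ∃₂ λ n q → approx j ≼ q × ∃ λ g → approx n ≡ extend g q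
    returns j none = reach (suc (target j)) λ (n , q , eq) →
      progress n q (suc (target j)) eq λ (n′ , r , _ , eq′) →
        none (n′ , q ++ r , ≼-trans (earlier n q eq) (extended r) , _ , cong proj₁ eq′)
      where
      earlier : ∀ n q → state n ≡ (q , suc (target j) , 0) → approx j ≼ q
      earlier n q eq = subst (approx j ≼_) (cong proj₁ eq) (approx-mono {j} {n} (ℕ.≮⇒≥ λ n<j →
        ℕ.<-irrefl refl (subst (_≤ target j) (cong (proj₁ ∘ proj₂) eq) (target-mono {n} {j} (ℕ.<⇒≤ n<j)))))

    -- The construction gives no bound on the stage at which `h` gets a value, so WLPO is asked
    -- whether `true` ever occurs, with `false` as the default.
    never-true? : ∀ h → Dec (∀ n → lookup (approx n) h ≢ just true)
    never-true? h = ∀-dec ℕ-enumeration λ n → ¬? (Maybe.≡-dec Bool._≟_ (lookup (approx n) h) (just true))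

    generic : 2^Δ
    generic h = not (does (never-true? h))

    approx⊂generic : ∀ n → approx n ⊂ generic
    approx⊂generic n = agreeing go
      where
      go : ∀ {h b} → lookup (approx n) h ≡ just b → generic h ≡ b
      go {h} {true}  eq = cong not (dec-false (never-true? h) λ never → never n eq)
      go {h} {false} eq = cong not (dec-true (never-true? h) λ m eq′ →
        case trans (sym (lookup-≼ (approx-mono (ℕ.m≤m⊔n m n)) eq′))
                   (lookup-≼ (approx-mono (ℕ.m≤n⊔m m n)) eq) of λ ())

    generic-free : IsFree generic
    generic-free = free-from-extensions λ g none → meets (indexΔ g) λ (n , q , _ , eq) → none (q ,
      subst (λ k → extend k q ⊂ generic) (enum-index Δ-enumeration g) (subst (_⊂ generic) eq (approx⊂generic n)))

    generic-returns : ∀ j → ¬ ¬ ∃ λ m → move (flipper m) (approx j) ⊂ generic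
    generic-returns j none = returns j λ (n , q , approx≼q , g , eq) →
      none (height (base g q) , agreeing λ {h} {b} eqh →
        let γ = flipper (height (base g q)) in
        -- The entry moved to `h` comes from `invΔ γ ·Δ h`, where `double-recurs` applies.
        trans (cong generic (sym (Δ.\\-leftDividesˡ γ h)))
          (double-recurs (base g q) (subst (_⊂ generic) eq (approx⊂generic n)) (invΔ γ ·Δ h)
            (lookup-≼ (≼-trans approx≼q (≼-base g q))
              (trans (sym (lookup-move γ (approx j) (invΔ γ ·Δ h)))
                (trans (cong (lookup (move γ (approx j))) (Δ.\\-leftDividesˡ γ h)) eqh)))))

-- The colouring at the generic point.

module NoColouring (c : Free → Fin 3) (borel : IsBorelMap c) (proper : IsProperColoring c) where
  open Colouring c borel proper
  open WLPO-from-colouring c borel proper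
  open Omniscience wlpo

  code : Fin 3 → BorelCode
  code i = proj₁ (borel i)

  abstract
    requirements : Enumeration (Δ × (Fin 3 × ℕ))
    requirements = ×-enumeration Δ-enumeration (×-enumeration Fin3-enumeration ℕ-enumeration)

  requirement : Δ × (Fin 3 × ℕ) → Condition → Set
  requirement (g , i , k) p = Decides p g (subcode (code i) k)

  open GenericPoint
    (λ n → requirement (enum requirements n))
    (λ n p → Decides? p _ _)
    (λ n p → Decides-dense _ _ p)

  meets-requirement : ∀ g i k → ¬ ¬ ∃ λ n → Decides (approx n) g (subcode (code i) k)
  meets-requirement g i k none = meets (index requirements (g , i , k)) λ (n , q , Dq , eq) →
    none (n , subst (λ p → Decides p g (subcode (code i) k)) (sym eq)
      (Decides-≼ (subcode (code i) k) (≼-extend _ q)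
        (subst (λ R → requirement R q) (enum-index requirements (g , i , k)) Dq)))
    where
    Decides-≼ : ∀ B {p q} → p ≼ q → Decides p g B → Decides q g B
    Decides-≼ B p≼q = Sum.map (⊩-≼ B p≼q) (⊩-≼ (compl B) p≼q)

  all-decided : ∀ i → AllDecided generic (code i)
  all-decided i g k none = meets-requirement g i k λ (n , Dn) → none (approx n , approx⊂generic n , Dn)

  G : Free
  G = generic , generic-free

  -- Some approximation decides this colour class, and the truth lemma rules out the negative
  -- decision.
  forces-colour : ∀ g → ¬ ¬ ∃ λ n → approx n ⊩[ g ] code (c (translate g G))
  forces-colour g none = meets-requirement g i 0 λ
    { (n , inj₁ ⊩B)  → none (n , ⊩B)
    ; (n , inj₂ ⊩¬B) → ⊩-compl-sound (code i) (approx n) (all-decided i) (approx⊂generic n) ⊩¬B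
        (proj₁ (proj₂ (borel i) (translate g G)) refl) }
    where i = c (translate g G)

  -- By equivariance the moved condition forces the same colour at the moved site, and it holds of
  -- the generic point. The truth lemma gives this doubly negated, which suffices because equality
  -- of colours is decidable.
  same-colour : ∀ g n m → approx n ⊩[ g ] code (c (translate g G)) → move (flipper m) (approx n) ⊂ generic →
    c (translate g (translate (flipper m) G)) ≡ c (translate g G)
  same-colour g n m ⊩B moved⊂ = trans
    (c-cong (translate g (translate γ G)) (translate (γ ·Δ g) G) (λ h → cong generic (sym (·Δ-assoc γ g h))))
    (decidable-stable (c (translate (γ ·Δ g) G) Fin.≟ i) λ differ →
      ⊩-sound (code i) (move γ (approx n)) (all-decided i) moved⊂ (⊩-move (code i) γ (approx n) ⊩B)
        (differ ∘ proj₂ (proj₂ (borel i) (translate (γ ·Δ g) G))))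
    where
    γ = flipper m
    i = c (translate g G)

  point : ℕ → Δ
  point k = + k , 0ℤ

  -- Double negation commutes with finite conjunctions, and a later approximation keeps what an
  -- earlier one forces.
  eventually-forces-line : ∀ N → ¬ ¬ ∃ λ n → ∀ k → k < N →
    approx n ⊩[ point k ] code (c (translate (point k) G))
  eventually-forces-line zero    none = none (0 , λ _ ())
  eventually-forces-line (suc N) none = eventually-forces-line N λ (n , old) →
    forces-colour (point N) λ (n′ , new) → none (n ⊔ n′ , λ k k<1+N → case ℕ.m≤n⇒m<n∨m≡n (ℕ.s≤s⁻¹ k<1+N) of λ
      { (inj₁ k<N)  → ⊩-≼ (code (c (translate (point k) G))) (approx-mono (ℕ.m≤m⊔n n n′)) (old k k<N)
      ; (inj₂ refl) → ⊩-≼ (code (c (translate (point k) G))) (approx-mono (ℕ.m≤n⊔m n n′)) new })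

  absurd : ⊥
  -- The winding number depends only on the colours at the vertices 0 to 4 of the 5-cycle.
  absurd = eventually-forces-line 5 λ (n , forces) → generic-returns n λ (m , moved⊂) →
    let at : ∀ k → k < 5 → line (translate (flipper m) G) (+ k) ≡ line G (+ k)
        at k k<5 = same-colour (point k) n m (forces k k<5) moved⊂
    in turning-flip-≢ m G (cycleSum-cong
         (at 0 (ℕ.s≤s ℕ.z≤n)) (at 2 (ℕ.m≤m+n 3 2)) (at 4 ℕ.≤-refl) (at 1 (ℕ.m≤m+n 2 3)) (at 3 (ℕ.m≤m+n 4 1)))

theorem13 : ¬ BorelColorable 3
theorem13 (c , borel , proper) = NoColouring.absurd c borel proper
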